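{- Let $\mathbf{f}$ be the Fibonacci word. There is a constant $c\le \frac{4}{\sqrt{5}}\phi\approx 2.89$, where $\phi=\frac{1+\sqrt5}{2}$, such that for every positive integer $k$ and every index $i\ge 0$, there is a $k$-antipower with block length at most $ck$ starting at index $i$ of $\mathbf{f}$.
   Context: The Fibonacci word is $\mathbf{f}=\sigma^{\omega}(0)$, where $\sigma$ is the morphism on $\{0,1\}^{\infty}$ with $\sigma(0)=01$, $\sigma(1)=0$ (so $\mathbf{f}$ is the infinite word having every $\sigma^n(0)$ as a prefix; $\mathbf{f}=0100101001001\cdots$). Words are indexed from $0$. A $k$-antipower with block length $b$ starting at index $i$ of a word $w$ means that the $k$ consecutive words $w_{i+jb}w_{i+jb+1}\cdots w_{i+(j+1)b-1}$, $j=0,\dots,k-1$, are pairwise distinct. -}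

module Defs where

open import Data.Nat using (ℕ; zero; suc; _+_; _*_; _∸_; _^_; _≤_; _<_)
open import Data.List using (List; []; _∷_; concatMap; map; upTo)
open import Data.Product using (_×_)
open import Relation.Binary.PropositionalEquality using (_≡_)
open import Relation.Nullary using (¬_)

-- letters of the alphabet {0,1} are represented by the naturals 0 and 1
Word : Set
Word = ℕ → ℕ

σ₁ : ℕ → List ℕ
σ₁ zero    = 0 ∷ 1 ∷ []
σ₁ (suc _) = 0 ∷ []

σ : List ℕ → List ℕ
σ = concatMap σ₁

σ^ : ℕ → List ℕ → List ℕ
σ^ zero    w = w
σ^ (suc n) w = σ (σ^ n w)

nth : List ℕ → ℕ → ℕ
nth []       _       = 0
nth (x ∷ _)  zero    = x
nth (_ ∷ xs) (suc n) = nth xs n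

-- The Fibonacci word f = σ^ω(0): letter n is read off the prefix σ^(n+1)(0),
-- which has length ≥ n + 2 > n (so the default is never used).
fib : Word
fib n = nth (σ^ (suc n) (0 ∷ [])) n

block : Word → ℕ → ℕ → ℕ → List ℕ
block w i b j = map (λ t → w (i + j * b + t)) (upTo b)

IsAntipower : Word → ℕ → ℕ → ℕ → Set
IsAntipower w k b i =
  ∀ j j′ → j < k → j′ < k → ¬ (j ≡ j′) → ¬ (block w i b j ≡ block w i b j′)

-- b ≤ (4/√5)·φ·k, where (4/√5)·φ = 2 + 2/√5; for natural b, k this is
-- equivalent to 5·(b ∸ 2k)² ≤ 4k².
WithinBound : ℕ → ℕ → Set
WithinBound b k = 5 * (b ∸ 2 * k) ^ 2 ≤ 4 * k ^ 2

{-# OPTIONS --safe #-}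
-- A block length b = 2Fₙ works whenever 2k ≤ Lₙ (Fibonacci and Lucas numbers), and the least
-- such n gives b ≤ (4/√5)φ k by Cassini's identity.
-- If two of the k blocks agreed, at distance 2dFₙ with d < k, then undoing σ in both windows
-- n − 1 times would exhibit 2dFₙ as |σⁿ⁻¹(u)| = Fₙ |u| + Fₙ₋₁ |u|₀ for a factor u of f.  By
-- coprimality Fₙ divides |u|₀.  If |u|₀ = 0 then |u| = 2d ≥ 2, but 11 is not a factor;
-- if |u|₀ ≥ Fₙ then |u| ≥ Fₙ₊₁ − 1 by balance, so 2d ≥ Fₙ₊₁ + Fₙ₋₁ − 1 > 2k − 2.
module Submission where

open import Defs
open import Data.Nat using (ℕ; zero; suc; _+_; _*_; _∸_; _≤_; _<_; z≤n; s≤s; >-nonZero)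
open import Data.Nat.Properties
open import Data.Nat.Coprimality using (Coprime; coprime-+; coprime-divisor; 1-coprimeTo)
  renaming (sym to coprime-sym)
open import Data.Nat.Divisibility using (_∣_; divides; ∣m+n∣m⇒∣n)
open import Data.Nat.Tactic.RingSolver using (solve-∀)
open import Data.List using (List; []; _∷_; _++_; length; map; take; upTo)
open import Data.List.Properties using (concatMap-++; length-++; ∷-injective)
open import Data.List.Membership.Propositional using (_∈_)
open import Data.List.Membership.Propositional.Properties using (∈-upTo⁺)
open import Data.List.Relation.Unary.Any using (here; there)
open import Data.Product using (Σ; ∃; ∃₂; _×_; _,_; proj₁; proj₂)
open import Data.Sum using (_⊎_; inj₁; inj₂)
open import Data.Empty using (⊥; ⊥-elim)
open import Relation.Nullary using (¬_; yes; no)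
open import Relation.Binary using (tri<; tri≈; tri>)
open import Relation.Binary.PropositionalEquality

-- Linear arithmetic without subtraction: the known bounds are added up to a ≤ b, and a ring
-- identity usually supplies the second premise.
≤-from-sum : ∀ {a b x y} → a ≤ b → x + b ≤ y + a → x ≤ y
≤-from-sum {a} {b} {x} {y} a≤b le =
  +-cancelʳ-≤ a x y (≤-trans (+-monoʳ-≤ x a≤b) le)

-- The Fibonacci word as a fixed point of σ

zeroBit : ℕ → ℕ
zeroBit zero    = 1
zeroBit (suc _) = 0

start : List ℕ → ℕ → ℕ
start w p = length (σ (take p w))

start-suc : ∀ w p → p < length w → start w (suc p) ≡ suc (zeroBit (nth w p) + start w p)
start-suc (zero  ∷ w) zero    _       = refl
start-suc (suc _ ∷ w) zero    _       = refl
start-suc (zero  ∷ w) (suc p) (s≤s h) =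
  trans (cong (2 +_) (start-suc w p h))
        (cong suc (trans (cong suc (sym (+-suc b s))) (sym (+-suc b (suc s)))))
  where b = zeroBit (nth w p)
        s = start w p
start-suc (suc _ ∷ w) (suc p) (s≤s h) =
  cong suc (trans (start-suc w p h) (sym (+-suc (zeroBit (nth w p)) (start w p))))

nth-start : ∀ w p → nth (σ w) (start w p) ≡ 0
nth-start []          zero    = refl
nth-start []          (suc p) = refl
nth-start (zero  ∷ w) zero    = refl
nth-start (suc _ ∷ w) zero    = refl
nth-start (zero  ∷ w) (suc p) = nth-start w p
nth-start (suc _ ∷ w) (suc p) = nth-start w p

nth-suc-start : ∀ w p → p < length w → nth w p ≡ 0 → nth (σ w) (suc (start w p)) ≡ 1
nth-suc-start (zero  ∷ w) zero    _       _  = refl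
nth-suc-start (zero  ∷ w) (suc p) (s≤s h) eq = nth-suc-start w p h eq
nth-suc-start (suc _ ∷ w) (suc p) (s≤s h) eq = nth-suc-start w p h eq

nth-σ-binary : ∀ w n → nth (σ w) n ≡ 0 ⊎ nth (σ w) n ≡ 1
nth-σ-binary []          _             = inj₁ refl
nth-σ-binary (zero  ∷ w) zero          = inj₁ refl
nth-σ-binary (zero  ∷ w) (suc zero)    = inj₂ refl
nth-σ-binary (zero  ∷ w) (suc (suc n)) = nth-σ-binary w n
nth-σ-binary (suc _ ∷ w) zero          = inj₁ refl
nth-σ-binary (suc _ ∷ w) (suc n)       = nth-σ-binary w n

nth-++ : ∀ u v n → n < length u → nth (u ++ v) n ≡ nth u n
nth-++ (_ ∷ _) v zero    _       = refl
nth-++ (_ ∷ u) v (suc n) (s≤s h) = nth-++ u v n h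

prefix : ℕ → List ℕ
prefix n = σ^ n (0 ∷ [])

σ-cons : ∀ x u → ∃₂ λ y v → σ (x ∷ u) ≡ y ∷ v
σ-cons zero    u = _ , _ , refl
σ-cons (suc _) u = _ , _ , refl

-- σ erases no letter, so applying it to a prefix and its nonempty remainder gives again a prefix
-- and a nonempty remainder.
prefix-extends : ∀ n → ∃₂ λ x u → prefix (suc n) ≡ prefix n ++ x ∷ u
prefix-extends zero = 1 , [] , refl
prefix-extends (suc n) =
  let x , u , eq  = prefix-extends n
      y , v , eq′ = σ-cons x u
  in y , v , trans (cong σ eq) (trans (concatMap-++ σ₁ (prefix n) (x ∷ u))
                                      (cong (prefix (suc n) ++_) eq′))

n<length-prefix : ∀ n → n < length (prefix n)
n<length-prefix zero = s≤s z≤n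
n<length-prefix (suc n) = let x , u , eq = prefix-extends n in
  subst (suc n <_) (sym (trans (cong length eq) (length-++ (prefix n))))
    (<-≤-trans (s≤s (n<length-prefix n))
      (subst (_≤ length (prefix n) + suc (length u)) (+-comm (length (prefix n)) 1)
        (+-monoʳ-≤ (length (prefix n)) (s≤s z≤n))))

nth-prefix-+ : ∀ d n → nth (prefix (d + n)) n ≡ nth (prefix n) n
nth-prefix-+ zero    n = refl
nth-prefix-+ (suc d) n = let x , u , eq = prefix-extends (d + n) in
  trans (cong (λ w → nth w n) eq)
    (trans (nth-++ (prefix (d + n)) (x ∷ u) n
              (≤-<-trans (m≤n+m n d) (n<length-prefix (d + n))))
           (nth-prefix-+ d n))

nth-prefix : ∀ {n N} → n ≤ N → nth (prefix N) n ≡ fib n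
nth-prefix {n} {N} n≤N =
  trans (cong (λ m → nth (prefix m) n) (sym (m∸n+n≡m n≤N)))
    (trans (nth-prefix-+ (N ∸ n) n) (sym (nth-prefix-+ 1 n)))

fib-binary : ∀ n → fib n ≡ 0 ⊎ fib n ≡ 1
fib-binary n = nth-σ-binary (prefix n) n

-- Counting zeros and locating images of letters

zeros : ℕ → ℕ
zeros zero    = 0
zeros (suc p) = zeroBit (fib p) + zeros p

-- G p = |σ(f₀ ⋯ f_{p-1})|, the position in f = σ(f) where the image of f_p starts.
G : ℕ → ℕ
G p = p + zeros p

start-prefix : ∀ {N} p → p ≤ N → start (prefix N) p ≡ G p
start-prefix zero    _   = refl
start-prefix {N} (suc p) p<N =
  trans (start-suc (prefix N) p (<-trans p<N (n<length-prefix N)))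
    (cong suc (trans (cong₂ (λ b s → zeroBit b + s) (nth-prefix (<⇒≤ p<N))
                                                    (start-prefix p (<⇒≤ p<N)))
                     (swap (zeroBit (fib p)) p (zeros p))))
  where
  swap : ∀ a b c → a + (b + c) ≡ b + (a + c)
  swap = solve-∀

p≤Gp : ∀ p → p ≤ G p
p≤Gp p = m≤m+n p (zeros p)

-- `prefix (suc N)` is σ applied to `prefix N`, so `start` locates the images of letters inside f
-- itself; each image begins with 0.
fib-G : ∀ p → fib (G p) ≡ 0
fib-G p = trans (sym (nth-prefix (n≤1+n (G p))))
  (subst (λ s → nth (prefix (suc (G p))) s ≡ 0) (start-prefix p (p≤Gp p))
    (nth-start (prefix (G p)) p))

fib-suc-G : ∀ p → fib p ≡ 0 → fib (suc (G p)) ≡ 1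
fib-suc-G p fp≡0 = trans (sym (nth-prefix (n≤1+n (suc (G p)))))
  (subst (λ s → nth (prefix (suc (suc (G p)))) (suc s) ≡ 1) (start-prefix p p≤N)
    (nth-suc-start (prefix (suc (G p))) p
      (≤-<-trans p≤N (n<length-prefix (suc (G p)))) (trans (nth-prefix p≤N) fp≡0)))
  where p≤N = m≤n⇒m≤1+n (p≤Gp p)

0≢1 : ∀ {x} → x ≡ 0 → x ≡ 1 → ⊥
0≢1 refl ()

zeros-suc-0 : ∀ p → fib p ≡ 0 → zeros (suc p) ≡ suc (zeros p)
zeros-suc-0 p eq = cong (λ x → zeroBit x + zeros p) eq

zeros-suc-1 : ∀ p → fib p ≡ 1 → zeros (suc p) ≡ zeros p
zeros-suc-1 p eq = cong (λ x → zeroBit x + zeros p) eq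

G-suc-0 : ∀ p → fib p ≡ 0 → G (suc p) ≡ suc (suc (G p))
G-suc-0 p eq = cong suc (trans (cong (p +_) (zeros-suc-0 p eq)) (+-suc p (zeros p)))

G-suc-1 : ∀ p → fib p ≡ 1 → G (suc p) ≡ suc (G p)
G-suc-1 p eq = cong (suc p +_) (zeros-suc-1 p eq)

-- Each of σ(0) = 01 and σ(1) = 0 contains exactly one zero.
zeros-G : ∀ p → zeros (G p) ≡ p
zeros-G zero = refl
zeros-G (suc p) with fib-binary p
... | inj₁ f0 = trans (cong zeros (G-suc-0 p f0))
      (trans (zeros-suc-1 (suc (G p)) (fib-suc-G p f0))
        (trans (zeros-suc-0 (G p) (fib-G p)) (cong suc (zeros-G p))))
... | inj₂ f1 = trans (cong zeros (G-suc-1 p f1))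
      (trans (zeros-suc-0 (G p) (fib-G p)) (cong suc (zeros-G p)))

G-cover : ∀ x → ∃ λ p → x ≡ G p ⊎ (fib p ≡ 0 × x ≡ suc (G p))
G-cover zero = 0 , inj₁ refl
G-cover (suc x) with G-cover x
... | p , inj₂ (f0 , eq) = suc p , inj₁ (trans (cong suc eq) (sym (G-suc-0 p f0)))
... | p , inj₁ eq with fib-binary p
... | inj₁ f0 = p , inj₂ (f0 , cong suc eq)
... | inj₂ f1 = suc p , inj₁ (trans (cong suc eq) (sym (G-suc-1 p f1)))

zeros-mono : ∀ {p q} → p ≤ q → zeros p ≤ zeros q
zeros-mono {p} {q} p≤q = subst (λ r → zeros p ≤ zeros r) (m∸n+n≡m p≤q) (go (q ∸ p))
  where
  go : ∀ d → zeros p ≤ zeros (d + p)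
  go zero    = ≤-refl
  go (suc d) = ≤-trans (go d) (m≤n+m (zeros (d + p)) (zeroBit (fib (d + p))))

zeros-suc-≤ : ∀ p → zeros (suc p) ≤ suc (zeros p)
zeros-suc-≤ p with fib-binary p
... | inj₁ f0 = ≤-reflexive (zeros-suc-0 p f0)
... | inj₂ f1 = m≤n⇒m≤1+n (≤-reflexive (zeros-suc-1 p f1))

-- Zero number w, counted from 0, stands at position `G w`. This lemma and the next three express
-- this as an adjunction between `zeros` and `G`.
zeros-≤ : ∀ {q w} → q ≤ G w → zeros q ≤ w
zeros-≤ {q} {w} q≤ = subst (zeros q ≤_) (zeros-G w) (zeros-mono q≤)

zeros-> : ∀ {q w} → G w < q → w < zeros q
zeros-> {q} {w} lt = subst (_≤ zeros q)
  (trans (zeros-suc-0 (G w) (fib-G w)) (cong suc (zeros-G w))) (zeros-mono lt)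

≤-G-zeros : ∀ p → p ≤ G (zeros p)
≤-G-zeros p = ≮⇒≥ (λ lt → <-irrefl refl (zeros-> lt))

G-< : ∀ {p w} → w < zeros p → G w < p
G-< lt = ≰⇒> (λ le → <⇒≱ lt (zeros-≤ le))

-- Balance: the number of zeros in windows of Fibonacci length

F : ℕ → ℕ
F zero          = 0
F (suc zero)    = 1
F (suc (suc n)) = F (suc n) + F n

F-pos : ∀ n → 1 ≤ F (suc n)
F-pos zero    = ≤-refl
F-pos (suc n) = ≤-trans (F-pos n) (m≤m+n _ _)

F-suc : ∀ n → ∃ λ c → F (suc n) ≡ suc c
F-suc n with F (suc n) | F-pos n
... | suc c | _ = c , refl

F-mono : ∀ n → F (suc n) ≤ F (suc (suc n))
F-mono n = m≤m+n _ _

-- Each bound follows from the other one index lower, because the zeros of f sit exactly at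
-- the positions G w, and so zeros q ≤ w holds iff q ≤ G w.
mutual
  zeros-upper : ∀ m p s → s + 2 ≤ F (suc m) → zeros (p + s) < zeros p + F m
  zeros-upper zero    p s h = ⊥-elim (<⇒≱ (s≤s (s≤s z≤n)) (≤-trans (m≤n+m 2 s) h))
  zeros-upper (suc m) p s h with F-suc m
  ... | c , Fm+1≡ = subst (zeros (p + s) <_)
          (trans (sym (+-suc (zeros p) c)) (cong (zeros p +_) (sym Fm+1≡)))
          -- It suffices that p + s ≤ G (zeros p + c). This follows from p ≤ G (zeros p) and the
          -- lower bound for the c letters from position `zeros p`.
          (s≤s (zeros-≤ {p + s} {zeros p + c} (≤-from-sum
            (+-mono-≤ (+-mono-≤ (≤-G-zeros p) h′)
                      (zeros-lower m (zeros p) c (≤-reflexive (trans Fm+1≡ (+-comm 1 c)))))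
            (≤-reflexive (arith p s (zeros p) (zeros (zeros p)) (zeros (zeros p + c)) c (F m))))))
    where
    h′ : s + 2 ≤ suc c + F m
    h′ = subst (λ x → s + 2 ≤ x + F m) Fm+1≡ h
    arith : ∀ p s w zw zwc c f →
      p + s + (w + zw + (suc c + f) + (zwc + 1)) ≡ w + c + zwc + (p + (s + 2) + (zw + f))
    arith = solve-∀

  zeros-lower : ∀ m p s → F (suc m) ≤ s + 1 → zeros p + F m ≤ zeros (p + s) + 1
  zeros-lower zero    p s h = subst (_≤ zeros (p + s) + 1) (sym (+-identityʳ (zeros p)))
    (≤-trans (zeros-mono (m≤m+n p s)) (m≤m+n _ 1))
  zeros-lower (suc m) p s h with F-suc m
  ... | c , Fm+1≡ = ≤-from-sum (count (zeros p) c refl refl)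
          (≤-reflexive (trans (cong (λ x → zeros p + x + zeros (p + s)) Fm+1≡)
                              (arith₀ (zeros p) c (zeros (p + s)))))
    where
    h′ : suc c + F m ≤ s + 1
    h′ = subst (λ x → x + F m ≤ s + 1) Fm+1≡ h
    upper : ∀ w d → c ≡ suc d → zeros (w + d) < zeros w + F m
    upper w d c≡ = zeros-upper m w d
      (≤-reflexive (trans (+-comm d 2) (sym (trans Fm+1≡ (cong suc c≡)))))
    -- A window of c = F (suc m) - 1 letters is one letter too long for `zeros-upper`; that letter
    -- adds at most one zero.
    upper-suc : ∀ w d → c ≡ d → zeros (w + d) ≤ zeros w + F m
    upper-suc w zero    _  =
      subst (λ x → zeros x ≤ zeros w + F m) (sym (+-identityʳ w)) (m≤m+n _ _)
    upper-suc w (suc d) c≡ = subst (λ x → zeros x ≤ zeros w + F m) (sym (+-suc w d))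
      (≤-trans (zeros-suc-≤ (w + d)) (upper w d c≡))
    arith₀ : ∀ w c z → w + suc c + z ≡ z + 1 + (w + c)
    arith₀ = solve-∀
    arith₁ : ∀ d z f s p → suc (d + z) + (s + 1 + f) + p ≡ p + s + (suc (suc d) + f + z)
    arith₁ = solve-∀
    arith₂ : ∀ s w zw z c f p →
      suc (w + c + z) + (p + (s + 1) + (zw + f)) ≡ p + s + (suc (w + zw) + (suc c + f) + z)
    arith₂ = solve-∀
    -- If zeros p = suc w, the last zero before p is at `G w` < p. If zeros p = 0 there is none, and
    -- zeros are counted from the start of f.
    count : ∀ w d → zeros p ≡ w → c ≡ d → w + d ≤ zeros (p + s)
    count zero    zero    _  _  = z≤n
    count zero    (suc d) _  c≡ = zeros-> (≤-from-sum
      (+-mono-≤ (subst (λ x → suc x + F m ≤ s + 1) c≡ h′) (<⇒≤ (upper 0 d c≡)))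
      (≤-trans (m≤m+n _ p) (≤-reflexive (arith₁ d (zeros d) (F m) s p))))
    count (suc w) d       w≡ c≡ = subst (λ x → suc w + x ≤ zeros (p + s)) c≡
      (zeros-> {p + s} (≤-from-sum
        (+-mono-≤ (+-mono-≤ (G-< {p} (≤-reflexive (sym w≡))) h′) (upper-suc w c refl))
        (≤-reflexive (arith₂ s w (zeros w) (zeros (w + c)) c (F m) p))))

-- Desubstitution of equal windows

-- H i p = |σⁱ(f₀ ⋯ f_{p-1})|, from |σⁱ(0)| = F (i + 2) and |σⁱ(1)| = F (i + 1).
H : ℕ → ℕ → ℕ
H i p = F (suc i) * p + F i * zeros p

H-G : ∀ i p → H i (G p) ≡ H (suc i) p
H-G i p = trans (cong (λ z → F (suc i) * G p + F i * z) (zeros-G p))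
                (arith (F (suc i)) (F i) p (zeros p))
  where
  arith : ∀ g f p z → g * (p + z) + f * p ≡ (g + f) * p + g * z
  arith = solve-∀

H-mono : ∀ i {p q} → p ≤ q → H i p ≤ H i q
H-mono i p≤q = +-mono-≤ (*-monoʳ-≤ (F (suc i)) p≤q) (*-monoʳ-≤ (F i) (zeros-mono p≤q))

H-suc-0 : ∀ i p → fib p ≡ 0 → H i (suc p) ≡ H i p + F (suc (suc i))
H-suc-0 i p f0 = trans (cong (λ z → F (suc i) * suc p + F i * z) (zeros-suc-0 p f0))
                       (arith (F (suc i)) (F i) p (zeros p))
  where
  arith : ∀ g f p z → g * suc p + f * suc z ≡ g * p + f * z + (g + f)
  arith = solve-∀

H-suc-≤ : ∀ i p → H i (suc p) ≤ H i p + F (suc (suc i))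
H-suc-≤ i p = ≤-trans (+-monoʳ-≤ (F (suc i) * suc p) (*-monoʳ-≤ (F i) (zeros-suc-≤ p)))
                      (≤-reflexive (arith (F (suc i)) (F i) p (zeros p)))
  where
  arith : ∀ g f p z → g * suc p + f * suc z ≡ g * p + f * z + (g + f)
  arith = solve-∀

Agree : ℕ → ℕ → ℕ → Set
Agree x y ℓ = ∀ t → t < ℓ → fib (t + x) ≡ fib (t + y)

agree-cons : ∀ {x y ℓ} → fib x ≡ fib y → Agree (suc x) (suc y) ℓ → Agree x y (suc ℓ)
agree-cons         eq _  zero    _       = eq
agree-cons {x} {y} _  as (suc t) (s≤s h) =
  subst₂ (λ u v → fib u ≡ fib v) (+-suc t x) (+-suc t y) (as t h)

agree-tail : ∀ {x y ℓ} → Agree x y (suc ℓ) → Agree (suc x) (suc y) ℓ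
agree-tail {x} {y} as t h =
  subst₂ (λ u v → fib u ≡ fib v) (sym (+-suc t x)) (sym (+-suc t y)) (as (suc t) (s≤s h))

agree-cast : ∀ {x x′ y y′ ℓ} → x ≡ x′ → y ≡ y′ → Agree x y ℓ → Agree x′ y′ ℓ
agree-cast refl refl as = as

-- The letter after position G p tells σ(0) from σ(1), so only the last letter of a window
-- can fail to be decoded.
desubstitute-aligned : ∀ L p q → Agree (G p) (G q) L →
  ∃ λ ℓ → Agree p q ℓ × L + G p ≤ suc (G (ℓ + p))
desubstitute-aligned zero       p q as = 0 , (λ _ ()) , n≤1+n (G p)
desubstitute-aligned (suc zero) p q as = 0 , (λ _ ()) , ≤-refl
desubstitute-aligned (suc (suc L)) p q as
  with fib-binary p | fib-binary q
     -- σ(0) takes up two letters of the window and σ(1) one, hence two induction hypotheses.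
     | desubstitute-aligned L (suc p) (suc q) | desubstitute-aligned (suc L) (suc p) (suc q)
... | inj₁ p0 | inj₁ q0 | ih | _ =
  let ℓ , as′ , le = ih
        (agree-cast (sym (G-suc-0 p p0)) (sym (G-suc-0 q q0)) (agree-tail (agree-tail as)))
  in suc ℓ , agree-cons (trans p0 (sym q0)) as′ ,
     subst₂ _≤_ (trans (cong (L +_) (G-suc-0 p p0)) (arith L (G p)))
                (cong (λ u → suc (G u)) (+-suc ℓ p)) le
  where
  arith : ∀ L g → L + suc (suc g) ≡ suc (suc L) + g
  arith = solve-∀
... | inj₂ p1 | inj₂ q1 | _ | ih =
  let ℓ , as′ , le = ih
        (agree-cast (sym (G-suc-1 p p1)) (sym (G-suc-1 q q1)) (agree-tail as))
  in suc ℓ , agree-cons (trans p1 (sym q1)) as′ ,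
     subst₂ _≤_ (trans (cong (suc L +_) (G-suc-1 p p1)) (+-suc (suc L) (G p)))
                (cong (λ u → suc (G u)) (+-suc ℓ p)) le
... | inj₁ p0 | inj₂ q1 | _ | _ = ⊥-elim (0≢1 (trans (cong fib (sym (G-suc-1 q q1))) (fib-G (suc q)))
  (trans (sym (as 1 (s≤s (s≤s z≤n)))) (fib-suc-G p p0)))
... | inj₂ p1 | inj₁ q0 | _ | _ = ⊥-elim (0≢1 (trans (cong fib (sym (G-suc-1 p p1))) (fib-G (suc p)))
  (trans (as 1 (s≤s (s≤s z≤n))) (fib-suc-G q q0)))

-- Equal first letters force both windows to start an image or both to start at the 1 of σ(0) = 01.
-- In the latter case both are extended left by a 0, which shifts the two weights `H i` equally and
-- so keeps their difference.
desubstitute : ∀ x y ℓ → Agree x y (suc ℓ) → ∃₂ λ p q → ∃ λ ℓ′ →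
  Agree p q ℓ′ × G p ≤ x × suc ℓ + x ≤ suc (G (ℓ′ + p)) ×
  (∀ i → H i y + H i (G p) ≡ H i x + H i (G q))
desubstitute x y ℓ as with G-cover x | G-cover y
... | p , inj₁ refl | q , inj₁ refl =
  let ℓ′ , as′ , le = desubstitute-aligned (suc ℓ) p q as
  in p , q , ℓ′ , as′ , ≤-refl , le , λ i → +-comm (H i (G q)) (H i (G p))
... | p , inj₂ (p0 , refl) | q , inj₂ (q0 , refl) =
  let ℓ′ , as′ , le = desubstitute-aligned (suc (suc ℓ)) p q
        (agree-cons (trans (fib-G p) (sym (fib-G q))) as)
  in p , q , ℓ′ , as′ , n≤1+n (G p) ,
     subst (_≤ suc (G (ℓ′ + p))) (sym (+-suc (suc ℓ) (G p))) le ,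
     λ i → trans (cong (_+ H i (G p)) (H-suc-0 i (G q) (fib-G q)))
             (trans (arith (H i (G q)) (F (suc (suc i))) (H i (G p)))
               (cong (_+ H i (G q)) (sym (H-suc-0 i (G p) (fib-G p)))))
  where
  arith : ∀ a f b → a + f + b ≡ b + f + a
  arith = solve-∀
... | p , inj₁ refl | q , inj₂ (q0 , refl) =
  ⊥-elim (0≢1 (fib-G p) (trans (as 0 (s≤s z≤n)) (fib-suc-G q q0)))
... | p , inj₂ (p0 , refl) | q , inj₁ refl =
  ⊥-elim (0≢1 (fib-G q) (trans (sym (as 0 (s≤s z≤n))) (fib-suc-G p p0)))

-- Level j loses at most one letter on the right, of weight at most |σ^j(0)| = F (j + 2);
-- over all levels j < i this adds up to F (i + 3) − 2.
descend : ∀ {x y ℓ} → Agree x y ℓ → ∀ i → F (suc (suc i)) ≤ suc ℓ → ∃₂ λ p q → ∃ λ ℓ′ →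
  Agree p q ℓ′ × H i p ≤ x × ℓ + x + 2 ≤ H i (ℓ′ + p) + F (3 + i) × y + H i p ≡ x + H i q
descend {x} {y} {ℓ} as zero _ = x , y , ℓ , as , ≤-reflexive (arith x (zeros x)) ,
  ≤-reflexive (cong (_+ 2) (sym (arith (ℓ + x) (zeros (ℓ + x))))) ,
  trans (cong (y +_) (arith x (zeros x)))
    (trans (+-comm y x) (cong (x +_) (sym (arith y (zeros y)))))
  where
  arith : ∀ p z → 1 * p + 0 * z ≡ p
  arith = solve-∀
descend {x} {y} {ℓ} as (suc i) long
  with descend as i (≤-trans (F-mono (suc i)) long)
-- An empty decoded window would give ℓ + 2 ≤ F (3 + i) ≤ ℓ + 1.
... | p , q , zero , as₁ , start≤ , end≥ , diff = ⊥-elim (<-irrefl {0} refl (≤-from-sum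
        (+-mono-≤ (+-mono-≤ start≤ end≥) long)
        (≤-reflexive (arith (H i p) x ℓ (F (3 + i))))))
  where
  arith : ∀ h x ℓ f → suc 0 + (x + (h + f) + suc ℓ) ≡ 0 + (h + (ℓ + x + 2) + f)
  arith = solve-∀
... | p , q , suc ℓ₁ , as₁ , start≤ , end≥ , diff with desubstitute p q ℓ₁ as₁
... | p′ , q′ , ℓ₂ , as₂ , Gp′≤p , end′ , diff′ =
  p′ , q′ , ℓ₂ , as₂ ,
  subst (_≤ x) (H-G i p′) (≤-trans (H-mono i Gp′≤p) start≤) ,
  (begin
    ℓ + x + 2                                             ≤⟨ end≥ ⟩
    H i (suc ℓ₁ + p) + F (3 + i)                          ≤⟨ +-monoˡ-≤ (F (3 + i)) (H-mono i end′) ⟩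
    H i (suc (G (ℓ₂ + p′))) + F (3 + i)                   ≤⟨ +-monoˡ-≤ (F (3 + i)) (H-suc-≤ i (G (ℓ₂ + p′))) ⟩
    H i (G (ℓ₂ + p′)) + F (2 + i) + F (3 + i)             ≡⟨ arith (H i (G (ℓ₂ + p′))) (F (2 + i)) (F (3 + i)) ⟩
    H i (G (ℓ₂ + p′)) + F (4 + i)                         ≡⟨ cong (_+ F (4 + i)) (H-G i (ℓ₂ + p′)) ⟩
    H (suc i) (ℓ₂ + p′) + F (4 + i)                       ∎) ,
  subst₂ (λ u v → y + u ≡ x + v) (H-G i p′) (H-G i q′)
    (+-cancelʳ-≡ (H i p + H i q) _ _
      (trans (arith₁ y (H i (G p′)) (H i p) (H i q))
        (trans (cong₂ _+_ diff (diff′ i)) (arith₂ x (H i q) (H i p) (H i (G q′))))))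
  where
  open ≤-Reasoning
  arith : ∀ h f g → h + f + g ≡ h + (g + f)
  arith = solve-∀
  arith₁ : ∀ y g p q → y + g + (p + q) ≡ y + p + (q + g)
  arith₁ = solve-∀
  arith₂ : ∀ x q p g → x + q + (p + g) ≡ x + g + (p + q)
  arith₂ = solve-∀

-- Impossible distances between equal windows

coprime-F : ∀ n → Coprime (F (suc n)) (F n)
coprime-F zero    = 1-coprimeTo 0
coprime-F (suc n) = coprime-+ (coprime-sym (coprime-F n))

-- With n = r + 2 this is 2d ≤ L_n − 2 for the Lucas number L_n = F (n + 1) + F (n − 1).
no-agreement : ∀ r d x → 1 ≤ d → 2 * d + 2 ≤ F (1 + r) + F (3 + r) →
  ¬ Agree x (x + d * (2 * F (2 + r))) (2 * F (2 + r))
no-agreement r d x 1≤d short as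
  with descend as (suc r) (m≤n⇒m≤1+n (≤-trans (+-monoʳ-≤ (F (2 + r)) (F-mono r))
                                              (≤-reflexive (double (F (2 + r))))))
  where
  double : ∀ f → f + f ≡ 2 * f
  double = solve-∀
... | p , q , _ , _ , _ , _ , diff
  -- The distance is positive and `H` is monotone, so p ≤ q. The factor u between p and q has length
  -- s and, below, b zeros.
  with m≤n⇒∃[o]m+o≡n {p} {q} (≰⇒≥ λ q≤p → <⇒≱ H-< (H-mono (suc r) q≤p))
  where
  f = F (2 + r)
  H-< : H (suc r) p < H (suc r) q
  H-< = +-cancelˡ-< x _ _ (subst (x + H (suc r) p <_) diff
    (+-monoˡ-< (H (suc r) p) (m<m+n x (*-mono-≤ 1≤d (*-mono-≤ (s≤s (z≤n {1})) (F-pos (suc r)))))))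
... | s , refl with m≤n⇒∃[o]m+o≡n {zeros p} {zeros (p + s)} (zeros-mono (m≤m+n p s))
... | b , zeros-q = contra f∣b
  where
  f = F (2 + r)
  g = F (1 + r)
  arith₁ : ∀ x d f g p z s b →
    f * (2 * d) + (x + (f * p + g * z)) ≡ x + d * (2 * f) + (f * p + g * z)
  arith₁ = solve-∀
  arith₂ : ∀ x f g p z s b →
    x + (f * (p + s) + g * (z + b)) ≡ f * s + g * b + (x + (f * p + g * z))
  arith₂ = solve-∀
  length-eq : f * (2 * d) ≡ f * s + g * b
  length-eq = +-cancelʳ-≡ (x + (f * p + g * zeros p)) _ _
    (trans (arith₁ x d f g p (zeros p) s b)
      (trans diff (trans (cong (λ u → x + (f * (p + s) + g * u)) (sym zeros-q))
                         (arith₂ x f g p (zeros p) s b))))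
  f∣b : f ∣ b
  f∣b = coprime-divisor (coprime-F (suc r))
    (∣m+n∣m⇒∣n (divides (2 * d) (trans (sym length-eq) (*-comm f (2 * d))))
               (divides s (*-comm f s)))
  arith₃ : ∀ f g s e → f * s + g * (e * f) ≡ f * (s + g * e)
  arith₃ = solve-∀
  contra : f ∣ b → ⊥
  contra (divides e b≡) = go e b≡
    (*-cancelˡ-≡ (2 * d) (s + g * e) f {{>-nonZero (F-pos (suc r))}}
      (trans length-eq (trans (cong (λ u → f * s + g * u) b≡) (arith₃ f g s e))))
    where
    go : ∀ e → b ≡ e * f → 2 * d ≡ s + g * e → ⊥
    -- Since F 4 = 3 and F 3 = 2, `zeros-lower 3 p 2` finds a zero among two consecutive letters: 11
    -- is not a factor.
    go zero b≡0 2d≡s = <-irrefl {zeros p} refl (≤-from-sum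
      (+-mono-≤ (zeros-lower 3 p 2 ≤-refl) (zeros-mono (+-monoʳ-≤ p 2≤s)))
      (≤-reflexive (trans (cong (λ u → suc (zeros p) + (zeros (p + 2) + 1 + u)) zeros-s)
                          (arith₄ (zeros p) (zeros (p + 2))))))
      where
      zeros-s : zeros (p + s) ≡ zeros p
      zeros-s = trans (sym zeros-q) (trans (cong (zeros p +_) b≡0) (+-identityʳ (zeros p)))
      2≤s : 2 ≤ s
      2≤s = subst (2 ≤_) (trans 2d≡s (trans (cong (s +_) (*-zeroʳ g)) (+-identityʳ s)))
                  (*-monoʳ-≤ 2 1≤d)
      arith₄ : ∀ z u → suc z + (u + 1 + z) ≡ z + (z + 2 + u)
      arith₄ = solve-∀
    -- Here 2d ≥ s + g, so `short` leaves s ≤ F (3 + r) - 2, and balance allows u fewer than f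
    -- zeros.
    go (suc e) b≡ 2d≡ = <⇒≱ (zeros-upper (2 + r) p s s-short)
      (subst (zeros p + f ≤_) (trans (cong (zeros p +_) (sym b≡)) zeros-q)
        (+-monoʳ-≤ (zeros p) (m≤m+n f (e * f))))
      where
      s-short : s + 2 ≤ F (3 + r)
      s-short = ≤-from-sum short (≤-trans (≤-reflexive (arith₅ s g (F (3 + r))))
        (+-monoʳ-≤ (F (3 + r)) (+-monoˡ-≤ 2 (≤-trans (+-monoʳ-≤ s (m≤m*n g (suc e)))
                                                     (≤-reflexive (sym 2d≡))))))
        where
        arith₅ : ∀ s g h → s + 2 + (g + h) ≡ h + (s + g + 2)
        arith₅ = solve-∀

-- From equal blocks to agreeing windows

map-injective-on : ∀ {f g : ℕ → ℕ} xs → map f xs ≡ map g xs → ∀ {t} → t ∈ xs → f t ≡ g t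
map-injective-on (x ∷ xs) eq (here refl) = proj₁ (∷-injective eq)
map-injective-on (x ∷ xs) eq (there t∈) = map-injective-on xs (proj₂ (∷-injective eq)) t∈

block-agree : ∀ i b j d → block fib i b j ≡ block fib i b (j + d) →
  Agree (i + j * b) (i + j * b + d * b) b
block-agree i b j d eq t t<b =
  subst₂ (λ u v → fib u ≡ fib v) (+-comm (i + j * b) t)
    (arith i j d b t) (map-injective-on (upTo b) eq (∈-upTo⁺ t<b))
  where
  arith : ∀ i j d b t → i + (j + d) * b + t ≡ t + (i + j * b + d * b)
  arith = solve-∀

-- Choice of the block length

-- The sign in Cassini's identity alternates, so the induction step exchanges the two bounds.
cassini : ∀ n → let a = F n; g = F (suc n) in
  g * g ≤ a * a + a * g + 1 × a * a + a * g ≤ g * g + 1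
cassini zero    = ≤-refl , z≤n
cassini (suc n) = let upper , lower = cassini n in
  ≤-from-sum lower (≤-reflexive (arith₁ (F n) (F (suc n)))) ,
  ≤-from-sum upper (≤-reflexive (arith₂ (F n) (F (suc n))))
  where
  arith₁ : ∀ a g → (g + a) * (g + a) + (g * g + 1) ≡ g * g + g * (g + a) + 1 + (a * a + a * g)
  arith₁ = solve-∀
  arith₂ : ∀ a g →
    g * g + g * (g + a) + (a * a + a * g + 1) ≡ (g + a) * (g + a) + 1 + g * g
  arith₂ = solve-∀

-- The Lucas number with index r + 1: 1, 3, 4, 7, ...
lucas : ℕ → ℕ
lucas r = F r + F (2 + r)

n≤F[2+n] : ∀ n → n ≤ F (2 + n)
n≤F[2+n] zero    = z≤n
n≤F[2+n] (suc n) = ≤-trans (≤-reflexive (+-comm 1 n)) (+-mono-≤ (n≤F[2+n] n) (F-pos n))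

n≤lucas : ∀ n → n ≤ lucas n
n≤lucas n = ≤-trans (n≤F[2+n] n) (m≤n+m (F (2 + n)) (F n))

-- Downward search from N; it can stop at r = 0 because `lucas 0` = 1 < m.
lucas-bracket : ∀ {m} → 1 < m → ∀ N → m ≤ lucas (suc N) →
  ∃ λ r → lucas r < m × m ≤ lucas (suc r)
lucas-bracket 1<m zero le = 0 , 1<m , le
lucas-bracket {m} 1<m (suc N) le with m ≤? lucas (suc N)
... | yes le′ = lucas-bracket 1<m N le′
... | no  nle = suc N , ≰⇒> nle , le

-- Write L = `lucas r` and g = `F (suc r)`. The block length is L + g and L < 2k, so the excess over
-- 2k is at most c = g - 1. Cassini gives 5g² ≤ L² + 4, and passing to g - 1 and L + 1 absorbs the
-- 4.
within-bound : ∀ r k → lucas r < 2 * k → WithinBound (2 * F (2 + r)) k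
within-bound r k lt with F-suc r | cassini r
... | c , g≡ | upper , _ = ≤-trans
    (*-monoʳ-≤ 5 (^-monoˡ-≤ 2 excess≤c))
    (≤-trans (≤-from-sum (*-monoʳ-≤ 4 upper′) (≤-trans (m≤m+n _ _) (≤-reflexive (arith₂ a c))))
      (≤-trans (*-mono-≤ sum≤ sum≤) (≤-reflexive (arith₃ k))))
  where
  a = F r
  upper′ : suc c * suc c ≤ a * a + a * suc c + 1
  upper′ = subst (λ g → g * g ≤ a * a + a * g + 1) g≡ upper
  arith₀ : ∀ a c → suc (a + (suc c + a)) ≡ 2 * a + c + 2
  arith₀ = solve-∀
  arith₁ : ∀ a c → 2 * (suc c + a) ≡ 2 * a + c + 2 + c
  arith₁ = solve-∀
  arith₂ : ∀ a c → 5 * (c * (c * 1)) + 4 * (a * a + a * suc c + 1) + (4 * a + 12 * c + 4)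
    ≡ (2 * a + c + 2) * (2 * a + c + 2) + 4 * (suc c * suc c)
  arith₂ = solve-∀
  arith₃ : ∀ k → 2 * k * (2 * k) ≡ 4 * (k * (k * 1))
  arith₃ = solve-∀
  sum≤ : 2 * a + c + 2 ≤ 2 * k
  sum≤ = subst (_≤ 2 * k) (trans (cong (λ g → suc (a + (g + a))) g≡) (arith₀ a c)) lt
  excess≤c : 2 * F (2 + r) ∸ 2 * k ≤ c
  excess≤c = m≤n+o⇒m∸n≤o _ (2 * k) (≤-trans
    (≤-reflexive (trans (cong (λ g → 2 * (g + a)) g≡) (arith₁ a c)))
    (+-monoˡ-≤ c sum≤))

theorem6 : (k i : ℕ) → 1 ≤ k →
    Σ ℕ (λ b → (1 ≤ b × WithinBound b k) × IsAntipower fib k b i)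
theorem6 k i 1≤k
  with lucas-bracket {2 * k} (*-monoʳ-≤ 2 1≤k) (2 * k)
         (≤-trans (n≤1+n (2 * k)) (n≤lucas (suc (2 * k))))
... | r , lower , upper = b , (1≤b , within-bound r k lower) , antipower
  where
  b = 2 * F (2 + r)
  1≤b : 1 ≤ b
  1≤b = *-mono-≤ (s≤s (z≤n {1})) (F-pos (suc r))
  distinct : ∀ {j j′} → j < j′ → j′ < k → ¬ (block fib i b j ≡ block fib i b j′)
  distinct {j} j<j′ j′<k eq with m≤n⇒∃[o]m+o≡n (<⇒≤ j<j′)
  ... | d , refl = no-agreement r d (i + j * b) 1≤d
        -- From d < k, 2d + 2 ≤ 2k ≤ `lucas (suc r)`.
        (≤-trans (≤-reflexive (arith d)) (≤-trans (*-monoʳ-≤ 2 d<k) upper))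
        (block-agree i b j d eq)
    where
    1≤d : 1 ≤ d
    1≤d = +-cancelˡ-≤ j 1 d (subst (_≤ j + d) (+-comm 1 j) j<j′)
    d<k : d < k
    d<k = ≤-<-trans (m≤n+m d j) j′<k
    arith : ∀ d → 2 * d + 2 ≡ 2 * suc d
    arith = solve-∀
  antipower : IsAntipower fib k b i
  antipower j j′ j<k j′<k j≢j′ eq with <-cmp j j′
  ... | tri< j<j′ _ _ = distinct j<j′ j′<k eq
  ... | tri≈ _ j≡j′ _ = j≢j′ j≡j′
  ... | tri> _ _ j>j′ = distinct j>j′ j<k (sym eq)
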